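{- Let $0\le \epsilon<1$ and $0\le\delta<1$, and consider an assignment of all the jobs $1,\dots,N$ to some machines with two properties: (a) each machine is $\epsilon$-full, and (b) each machine is $\delta$-homogeneous. Then the number of purchased machines in this assignment is at most $$\frac{\mathrm{OPT}}{(1-\epsilon)^2(1-\delta)},$$ where $\mathrm{OPT}$ is the minimum number of machines needed to serve all the jobs.
   Context: Submodular bin packing, normalized so that the machine capacity and the risk coefficient both equal $1$: each job $j\in\{1,\dots,N\}$ has parameters $\mu_j\ge0$ and $b_j\ge0$. For a set $S$ of jobs, $\mathrm{Cost}(S)=\sum_{j\in S}\mu_j+\sqrt{\sum_{j\in S}b_j}$, and $S$ is feasible if $\mathrm{Cost}(S)\le 1$; every single job is assumed feasible. $\mathrm{OPT}$ is the minimum number of feasible sets into which the $N$ jobs can be partitioned. An assignment of all jobs to machines is a partition of $\{1,\dots,N\}$ into nonempty sets, one per purchased machine. A machine with job set $S$ is $\epsilon$-full if $\mathrm{Cost}(S)\ge 1-\epsilon$. The ratio $b_j/\mu_j\in[0,+\infty]$ is by convention $+\infty$ when $\mu_j=0$. A machine is $\delta$-homogeneous if for any two jobs $j,j'$ assigned to it the ratios $b_j/\mu_j$ and $b_{j'}/\mu_{j'}$ differ by at most a multiplicative factor $1+\delta$, i.e. $\frac{b_j}{\mu_j}\le(1+\delta)\frac{b_{j'}}{\mu_{j'}}$ for every ordered pair $(j,j')$ of jobs in the machine. -}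

module Defs where

open import Algebra.Bundles using (CommutativeRing)
open import Data.Bool.Base using (if_then_else_)
open import Data.Fin.Base using (Fin)
import Data.Fin.Properties as Fin
open import Data.Fin.Subset using (Subset; _∈_; ⁅_⁆)
open import Data.Maybe.Base as Maybe using ()
open import Data.Nat.Base as ℕ using (ℕ)
open import Data.Product.Base using (∃; _×_)
open import Data.Vec.Base using (lookup; tabulate)
open import Function.Definitions using (StrictlySurjective)
open import Level using (suc; _⊔_)
open import Relation.Binary.Core using (Rel)
open import Relation.Binary.PropositionalEquality.Core using (_≡_)
open import Relation.Binary.Structures using (IsDecTotalOrder)
open import Relation.Nullary.Construct.Add.Supremum using (_⁺; ⊤⁺; [_])
open import Relation.Nullary.Decidable.Core using (does)
open import Relation.Nullary.Negation.Core using (¬_)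
open import Relation.Unary using (Pred)

import Algebra.Definitions.RawMonoid as RawMonoidDefs
import Relation.Binary.Construct.Add.Supremum.NonStrict as AddSupremum
import Relation.Binary.Construct.NonStrictToStrict as NonStrictToStrict

-- The classical real numbers, axiomatised as a Dedekind-complete ordered field
-- (which is unique up to isomorphism) with decidable order.  The operations
-- _⁻¹ and √ are total, but nothing is assumed about 0# ⁻¹ or about the square
-- root of a negative number.  Completeness already determines √ on nonnegative
-- numbers; it is a field only so that it need not be constructed from suprema.

record Reals c ℓ₁ ℓ₂ : Set (suc (c ⊔ ℓ₁ ⊔ ℓ₂)) where
  infix  4 _≤_
  infix  8 _⁻¹
  infixl 7 _/_

  field
    commutativeRing : CommutativeRing c ℓ₁

  open CommutativeRing commutativeRing public

  field
    0≉1          : ¬ (0# ≈ 1#)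
    _⁻¹          : Carrier → Carrier
    *-inverseʳ   : ∀ {x} → ¬ (x ≈ 0#) → x * x ⁻¹ ≈ 1#

    _≤_             : Rel Carrier ℓ₂
    isDecTotalOrder : IsDecTotalOrder _≈_ _≤_
    +-monoʳ-≤       : ∀ x {y z} → y ≤ z → x + y ≤ x + z
    *-nonNegative   : ∀ {x y} → 0# ≤ x → 0# ≤ y → 0# ≤ x * y

  UpperBound : ∀ {p} → Pred Carrier p → Pred Carrier (c ⊔ ℓ₂ ⊔ p)
  UpperBound P u = ∀ x → P x → x ≤ u

  field
    complete : (P : Pred Carrier ℓ₂) → ∃ P → ∃ (UpperBound P) →
               ∃ λ s → UpperBound P s × (∀ u → UpperBound P u → s ≤ u)

    √_            : Carrier → Carrier
    √-nonNegative : ∀ {x} → 0# ≤ x → 0# ≤ √ x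
    √-square      : ∀ {x} → 0# ≤ x → √ x * √ x ≈ x

  open IsDecTotalOrder isDecTotalOrder public using (_≟_; _≤?_)
  open NonStrictToStrict _≈_ _≤_ public using (_<_)
  open AddSupremum _≤_ public using (_≤⁺_)
  open RawMonoidDefs +-rawMonoid public using (sum) renaming (_×_ to _·_)

  _/_ : Carrier → Carrier → Carrier
  x / y = x * y ⁻¹

  fromℕ : ℕ → Carrier
  fromℕ n = n · 1#

-- A partition of N jobs into m nonempty sets, one per machine.

record Assignment (N m : ℕ) : Set where
  field
    machine  : Fin N → Fin m
    nonempty : StrictlySurjective _≡_ machine

  jobs : Fin m → Subset N
  jobs i = tabulate λ j → does (machine j Fin.≟ i)

open Assignment public using (jobs)

module SubmodularBinPacking {c ℓ₁ ℓ₂} (ℝ : Reals c ℓ₁ ℓ₂) where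

  open Reals ℝ

  Σ[_]_ : ∀ {N} → Subset N → (Fin N → Carrier) → Carrier
  Σ[ S ] f = sum λ j → if lookup S j then f j else 0#

  module _ {N : ℕ} (μ b : Fin N → Carrier) where

    Cost : Subset N → Carrier
    Cost S = Σ[ S ] μ + √ (Σ[ S ] b)

    Feasible : Subset N → Set ℓ₂
    Feasible S = Cost S ≤ 1#

    FeasibleAssignment : ∀ {m} → Assignment N m → Set ℓ₂
    FeasibleAssignment A = ∀ i → Feasible (jobs A i)

    IsOPT : ℕ → Set ℓ₂
    IsOPT k = (∃ λ (A : Assignment N k) → FeasibleAssignment A)
            × (∀ {m} (A : Assignment N m) → FeasibleAssignment A → k ℕ.≤ m)

    Full : Carrier → Subset N → Set ℓ₂
    Full ε S = 1# - ε ≤ Cost S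

    -- b j / μ j in [0, +∞], where ⊤⁺ is +∞.
    ratio : Fin N → Carrier ⁺
    ratio j = if does (μ j ≟ 0#) then ⊤⁺ else [ b j / μ j ]

    -- Scaling [0, +∞] by a positive real, hence fixing +∞.
    scale : Carrier → Carrier ⁺ → Carrier ⁺
    scale a = Maybe.map (a *_)

    Homogeneous : Carrier → Subset N → Set (c ⊔ ℓ₂)
    Homogeneous δ S = ∀ {j j′} → j ∈ S → j′ ∈ S →
                      ratio j ≤⁺ scale (1# + δ) (ratio j′)

    record IsInstance : Set ℓ₂ where
      field
        μ-nonNegative  : ∀ j → 0# ≤ μ j
        b-nonNegative  : ∀ j → 0# ≤ b j
        singleFeasible : ∀ j → Feasible ⁅ j ⁆

{-# OPTIONS --safe #-}
-- Assign to each job the fraction w(μ, b) of a machine that it occupies when the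
-- machine is filled with scaled copies of that job. Since {μ + √ b ≥ 1} is convex
-- in the quadrant, w is concave and positively homogeneous, hence superadditive, so
-- a feasible set has total weight at most w of its total, which is at most 1. On a
-- δ-homogeneous machine all jobs are nearly proportional, so the sum of their weights
-- is at least w of the total divided by 1 + δ, and for an ε-full machine w of the
-- total is at least (1 - ε)². Summing the weights of all jobs machine by machine in
-- the given assignment and in an optimal one compares the numbers of machines.

module Submission where

open import Defs
open import Data.Nat.Base using (ℕ; zero; suc)
open import Data.Fin.Base using (Fin; zero; suc)
open import Data.Bool.Base using (true; false; if_then_else_)
import Data.Fin.Properties as Fin
open import Data.Fin.Subset using (Subset; _∈_)
open import Data.Product.Base using (_,_; proj₁)
open import Data.Sum.Base using (inj₁; inj₂)
open import Data.Vec.Base using (lookup)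
open import Data.Vec.Properties using (lookup⇒[]=; lookup∘tabulate)
open import Relation.Binary.Bundles using (Poset)
open import Relation.Binary.Construct.Add.Supremum.NonStrict using ([_])
open import Relation.Binary.PropositionalEquality.Core as ≡ using ()
open import Relation.Binary.Structures using (IsDecTotalOrder)
open import Relation.Nullary.Decidable.Core using (does; yes; no)
open import Relation.Nullary.Negation.Core using (¬_)

import Algebra.Properties.Ring as RingProperties
import Algebra.Properties.Semiring.Sum as SemiringSum
import Algebra.Solver.Ring.NaturalCoefficients.Default as RingSolver
import Relation.Binary.Reasoning.PartialOrder as PartialOrderReasoning

-- Arithmetic of ordered fields.

module Order {c ℓ₁ ℓ₂} (ℝ : Reals c ℓ₁ ℓ₂) where

  open Reals ℝ public
  open IsDecTotalOrder isDecTotalOrder public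
    using (isPartialOrder; antisym; total; ≤-respˡ-≈; ≤-respʳ-≈)
    renaming (refl to ≤-refl; reflexive to ≤-reflexive; trans to ≤-trans)
  open RingProperties ring public using (-‿distribˡ-*; -‿distribʳ-*; -‿involutive)
  open RingSolver commutativeSemiring public using (solve; _:+_; _:*_; _:=_)

  poset : Poset c ℓ₁ ℓ₂
  poset = record { isPartialOrder = isPartialOrder }

  open PartialOrderReasoning poset public

  +-monoˡ-≤ : ∀ x {y z} → y ≤ z → y + x ≤ z + x
  +-monoˡ-≤ x {y} {z} y≤z = begin
    y + x  ≈⟨ +-comm y x ⟩
    x + y  ≤⟨ +-monoʳ-≤ x y≤z ⟩
    x + z  ≈⟨ +-comm x z ⟩
    z + x  ∎

  +-mono-≤ : ∀ {x y u v} → x ≤ y → u ≤ v → x + u ≤ y + v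
  +-mono-≤ x≤y u≤v = ≤-trans (+-monoˡ-≤ _ x≤y) (+-monoʳ-≤ _ u≤v)

  +-nonNegative : ∀ {x y} → 0# ≤ x → 0# ≤ y → 0# ≤ x + y
  +-nonNegative 0≤x 0≤y = ≤-respˡ-≈ (+-identityˡ 0#) (+-mono-≤ 0≤x 0≤y)

  x≤x+y : ∀ x {y} → 0# ≤ y → x ≤ x + y
  x≤x+y x 0≤y = ≤-respˡ-≈ (+-identityʳ x) (+-monoʳ-≤ x 0≤y)

  x≤y+x : ∀ x {y} → 0# ≤ y → x ≤ y + x
  x≤y+x x 0≤y = ≤-respˡ-≈ (+-identityˡ x) (+-monoˡ-≤ x 0≤y)

  x+[y-x]≈y : ∀ x y → x + (y - x) ≈ y
  x+[y-x]≈y x y = begin-equality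
    x + (y - x)    ≈⟨ solve 3 (λ x y z → x :+ (y :+ z) := y :+ (x :+ z)) refl x y (- x) ⟩
    y + (x - x)    ≈⟨ +-congˡ (-‿inverseʳ x) ⟩
    y + 0#         ≈⟨ +-identityʳ y ⟩
    y              ∎

  +-cancelˡ-≤ : ∀ x {y z} → x + y ≤ x + z → y ≤ z
  +-cancelˡ-≤ x {y} {z} x+y≤x+z = begin
    y              ≈⟨ lemma y ⟨
    - x + (x + y)  ≤⟨ +-monoʳ-≤ (- x) x+y≤x+z ⟩
    - x + (x + z)  ≈⟨ lemma z ⟩
    z              ∎
    where
    lemma : ∀ w → - x + (x + w) ≈ w
    lemma w = trans (sym (+-assoc _ _ _)) (trans (+-congʳ (-‿inverseˡ x)) (+-identityˡ w))

  y-x-nonNegative : ∀ {x y} → x ≤ y → 0# ≤ y - x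
  y-x-nonNegative {x} {y} x≤y =
    +-cancelˡ-≤ x (≤-respˡ-≈ (sym (+-identityʳ x)) (≤-respʳ-≈ (sym (x+[y-x]≈y x y)) x≤y))

  x+y≤z⇒x≤z-y : ∀ {x y z} → x + y ≤ z → x ≤ z - y
  x+y≤z⇒x≤z-y {x} {y} {z} x+y≤z = +-cancelˡ-≤ y
    (≤-respˡ-≈ (+-comm x y) (≤-respʳ-≈ (sym (x+[y-x]≈y y z)) x+y≤z))

  x≤y+z⇒x-z≤y : ∀ {x y z} → x ≤ y + z → x - z ≤ y
  x≤y+z⇒x-z≤y {x} {y} {z} x≤y+z = +-cancelˡ-≤ z
    (≤-respʳ-≈ (+-comm y z) (≤-respˡ-≈ (sym (x+[y-x]≈y z x)) x≤y+z))

  *-monoʳ-≤ : ∀ {x y z} → 0# ≤ x → y ≤ z → x * y ≤ x * z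
  *-monoʳ-≤ {x} {y} {z} 0≤x y≤z = begin
    x * y                ≤⟨ x≤x+y _ (*-nonNegative 0≤x (y-x-nonNegative y≤z)) ⟩
    x * y + x * (z - y)  ≈⟨ distribˡ x y (z - y) ⟨
    x * (y + (z - y))    ≈⟨ *-congˡ (x+[y-x]≈y y z) ⟩
    x * z                ∎

  *-monoˡ-≤ : ∀ {x y z} → 0# ≤ x → y ≤ z → y * x ≤ z * x
  *-monoˡ-≤ {x} {y} {z} 0≤x y≤z =
    ≤-respˡ-≈ (*-comm x y) (≤-respʳ-≈ (*-comm x z) (*-monoʳ-≤ 0≤x y≤z))

  *-mono-≤ : ∀ {x y u v} → 0# ≤ x → 0# ≤ v → x ≤ y → u ≤ v → x * u ≤ y * v
  *-mono-≤ 0≤x 0≤v x≤y u≤v = ≤-trans (*-monoʳ-≤ 0≤x u≤v) (*-monoˡ-≤ 0≤v x≤y)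

  -- If y ≤ x, then x + x ≤ y + y ≤ x + y, and x cancels.
  x+x≤y+y⇒x≤y : ∀ {x y} → x + x ≤ y + y → x ≤ y
  x+x≤y+y⇒x≤y {x} {y} x+x≤y+y with total x y
  ... | inj₁ x≤y = x≤y
  ... | inj₂ y≤x = +-cancelˡ-≤ x (≤-trans x+x≤y+y (+-monoˡ-≤ y y≤x))

  square-nonNegative : ∀ x → 0# ≤ x * x
  square-nonNegative x with total 0# x
  ... | inj₁ 0≤x = *-nonNegative 0≤x 0≤x
  ... | inj₂ x≤0 = ≤-respʳ-≈ -x*-x≈x*x (*-nonNegative 0≤-x 0≤-x)
    where
    0≤-x : 0# ≤ - x
    0≤-x = ≤-respʳ-≈ (+-identityˡ (- x)) (y-x-nonNegative x≤0)
    -x*-x≈x*x : - x * - x ≈ x * x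
    -x*-x≈x*x = begin-equality
      - x * - x      ≈⟨ -‿distribˡ-* x (- x) ⟨
      - (x * - x)    ≈⟨ -‿cong (-‿distribʳ-* x x) ⟨
      - (- (x * x))  ≈⟨ -‿involutive (x * x) ⟩
      x * x          ∎

  0≤1 : 0# ≤ 1#
  0≤1 = ≤-respʳ-≈ (*-identityˡ 1#) (square-nonNegative 1#)

  -- The inverse of x is x times the square of that inverse.
  ⁻¹-nonNegative : ∀ {x} → 0# < x → 0# ≤ x ⁻¹
  ⁻¹-nonNegative {x} (0≤x , 0≉x) = ≤-respʳ-≈ lemma (*-nonNegative 0≤x (square-nonNegative (x ⁻¹)))
    where
    lemma : x * (x ⁻¹ * x ⁻¹) ≈ x ⁻¹
    lemma = trans (sym (*-assoc _ _ _))
      (trans (*-congʳ (*-inverseʳ (λ x≈0 → 0≉x (sym x≈0)))) (*-identityˡ _))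

  x*y/x≈y : ∀ {x} y → ¬ (x ≈ 0#) → x * y / x ≈ y
  x*y/x≈y {x} y x≉0 = begin-equality
    x * y * x ⁻¹    ≈⟨ solve 3 (λ x y z → x :* y :* z := y :* (x :* z)) refl x y (x ⁻¹) ⟩
    y * (x * x ⁻¹)  ≈⟨ *-congˡ (*-inverseʳ x≉0) ⟩
    y * 1#          ≈⟨ *-identityʳ y ⟩
    y               ∎

  *-cancelˡ-≤ : ∀ {x y z} → 0# < x → x * y ≤ x * z → y ≤ z
  *-cancelˡ-≤ {x} {y} {z} 0<x@(_ , 0≉x) xy≤xz =
    ≤-respˡ-≈ (x*y/x≈y y x≉0) (≤-respʳ-≈ (x*y/x≈y z x≉0) (*-monoˡ-≤ (⁻¹-nonNegative 0<x) xy≤xz))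
    where
    x≉0 : ¬ (x ≈ 0#)
    x≉0 x≈0 = 0≉x (sym x≈0)

  *-positive : ∀ {x y} → 0# < x → 0# < y → 0# < x * y
  *-positive {x} {y} (0≤x , 0≉x) (0≤y , 0≉y) = *-nonNegative 0≤x 0≤y , λ 0≈xy → 0≉y (begin-equality
    0#            ≈⟨ zeroˡ (x ⁻¹) ⟨
    0# / x        ≈⟨ *-congʳ 0≈xy ⟩
    x * y / x     ≈⟨ x*y/x≈y y (λ x≈0 → 0≉x (sym x≈0)) ⟩
    y             ∎)

  y-x-positive : ∀ {x y} → x < y → 0# < y - x
  y-x-positive {x} {y} (x≤y , x≉y) = y-x-nonNegative x≤y , λ 0≈y-x → x≉y (begin-equality
    x            ≈⟨ +-identityʳ x ⟨
    x + 0#       ≈⟨ +-congˡ 0≈y-x ⟩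
    x + (y - x)  ≈⟨ x+[y-x]≈y x y ⟩
    y            ∎)

  x*z≤y⇒x≤y/z : ∀ {x y z} → 0# < z → x * z ≤ y → x ≤ y / z
  x*z≤y⇒x≤y/z {x} {y} {z} 0<z@(_ , 0≉z) xz≤y = begin
    x          ≈⟨ x*y/x≈y x (λ z≈0 → 0≉z (sym z≈0)) ⟨
    z * x / z  ≤⟨ *-monoˡ-≤ (⁻¹-nonNegative 0<z) (≤-respˡ-≈ (*-comm x z) xz≤y) ⟩
    y / z      ∎

  -- Multiplied by x + y, the claim becomes the hypothesis with `y * x` added on both sides. The
  -- case x + y = 0 is split off because this factor has to be cancelled.
  square-cancel-≤ : ∀ {x y} → 0# ≤ x → 0# ≤ y → x * x ≤ y * y → x ≤ y
  square-cancel-≤ {x} {y} 0≤x 0≤y xx≤yy with 0# ≟ x + y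
  ... | yes 0≈x+y = begin
    x      ≤⟨ x≤x+y x 0≤y ⟩
    x + y  ≈⟨ 0≈x+y ⟨
    0#     ≤⟨ 0≤y ⟩
    y      ∎
  ... | no 0≉x+y = *-cancelˡ-≤ (+-nonNegative 0≤x 0≤y , 0≉x+y) (begin
    (x + y) * x    ≈⟨ distribʳ x x y ⟩
    x * x + y * x  ≤⟨ +-monoˡ-≤ (y * x) xx≤yy ⟩
    y * y + y * x  ≈⟨ solve 2 (λ x y → y :* y :+ y :* x := (x :+ y) :* y) refl x y ⟩
    (x + y) * y    ∎)

  -- Square roots and the Cauchy-Schwarz inequality.

  √-upper : ∀ {x y} → 0# ≤ x → 0# ≤ y → x ≤ y * y → √ x ≤ y
  √-upper 0≤x 0≤y x≤yy =
    square-cancel-≤ (√-nonNegative 0≤x) 0≤y (≤-respˡ-≈ (sym (√-square 0≤x)) x≤yy)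

  √-lower : ∀ {x y} → 0# ≤ y → y * y ≤ x → y ≤ √ x
  √-lower {x} {y} 0≤y yy≤x = square-cancel-≤ 0≤y (√-nonNegative 0≤x) (≤-respʳ-≈ (sym (√-square 0≤x)) yy≤x)
    where
    0≤x : 0# ≤ x
    0≤x = ≤-trans (square-nonNegative y) yy≤x

  √-unique : ∀ {x y} → 0# ≤ y → y * y ≈ x → √ x ≈ y
  √-unique {x} {y} 0≤y yy≈x = antisym
    (√-upper (≤-respʳ-≈ yy≈x (square-nonNegative y)) 0≤y (≤-reflexive (sym yy≈x)))
    (√-lower 0≤y (≤-reflexive yy≈x))

  √-mono : ∀ {x y} → 0# ≤ x → x ≤ y → √ x ≤ √ y
  √-mono 0≤x x≤y = √-lower (√-nonNegative 0≤x) (≤-respˡ-≈ (sym (√-square 0≤x)) x≤y)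

  4xy≤[x+y]² : ∀ x y → (x * y + x * y) + (x * y + x * y) ≤ (x + y) * (x + y)
  4xy≤[x+y]² x y = begin
    (x * y + x * y) + (x * y + x * y)          ≤⟨ x≤x+y _ (square-nonNegative (x - y)) ⟩
    -- With `x` written as `y + d`, the identity (x + y)² = 4xy + (x - y)² becomes one of semirings.
    4xy + (x - y) * (x - y)                    ≈⟨ +-congʳ (+-cong (+-cong x≈ x≈) (+-cong x≈ x≈)) ⟩
    ((y + d) * y + (y + d) * y) + ((y + d) * y + (y + d) * y) + d * d
      ≈⟨ solve 2 (λ y d → (((y :+ d) :* y :+ (y :+ d) :* y) :+ ((y :+ d) :* y :+ (y :+ d) :* y)) :+ d :* d
                         := ((y :+ d) :+ y) :* ((y :+ d) :+ y)) refl y d ⟩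
    ((y + d) + y) * ((y + d) + y)              ≈⟨ *-cong (+-congʳ (x+[y-x]≈y y x)) (+-congʳ (x+[y-x]≈y y x)) ⟩
    (x + y) * (x + y)                          ∎
    where
    d = x - y
    4xy = (x * y + x * y) + (x * y + x * y)
    x≈ : x * y ≈ (y + d) * y
    x≈ = *-congʳ (sym (x+[y-x]≈y y x))

  -- Cauchy-Schwarz for the vectors (√x, √u) and (√y, √v). After squaring, only the mixed terms
  -- differ; they are compared in `cross`.
  √-superadditive : ∀ {x y u v} → 0# ≤ x → 0# ≤ y → 0# ≤ u → 0# ≤ v →
                    √ (x * y) + √ (u * v) ≤ √ ((x + u) * (y + v))
  √-superadditive {x} {y} {u} {v} 0≤x 0≤y 0≤u 0≤v = √-lower (+-nonNegative 0≤p 0≤q) (begin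
    (p + q) * (p + q)
      ≈⟨ solve 2 (λ p q → (p :+ q) :* (p :+ q) := p :* p :+ q :* q :+ (p :* q :+ p :* q)) refl p q ⟩
    p * p + q * q + (p * q + p * q)
      ≤⟨ +-mono-≤ (≤-reflexive (+-cong pp≈ qq≈)) cross ⟩
    x * y + u * v + (x * v + u * y)
      ≈⟨ solve 4 (λ x y u v → x :* y :+ u :* v :+ (x :* v :+ u :* y) := (x :+ u) :* (y :+ v)) refl x y u v ⟩
    (x + u) * (y + v)  ∎)
    where
    p = √ (x * y)
    q = √ (u * v)
    0≤xy = *-nonNegative 0≤x 0≤y
    0≤uv = *-nonNegative 0≤u 0≤v
    0≤p : 0# ≤ p
    0≤p = √-nonNegative 0≤xy
    0≤q : 0# ≤ q
    0≤q = √-nonNegative 0≤uv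
    pp≈ : p * p ≈ x * y
    pp≈ = √-square 0≤xy
    qq≈ : q * q ≈ u * v
    qq≈ = √-square 0≤uv
    pqpq≈ : (p * q) * (p * q) ≈ (x * v) * (u * y)
    pqpq≈ = begin-equality
      (p * q) * (p * q)  ≈⟨ solve 2 (λ p q → (p :* q) :* (p :* q) := (p :* p) :* (q :* q)) refl p q ⟩
      (p * p) * (q * q)  ≈⟨ *-cong pp≈ qq≈ ⟩
      (x * y) * (u * v)  ≈⟨ solve 4 (λ x y u v → (x :* y) :* (u :* v) := (x :* v) :* (u :* y)) refl x y u v ⟩
      (x * v) * (u * y)  ∎
    -- AM-GM for `x * v` and `u * y`, whose product is the square of `p * q`.
    cross : p * q + p * q ≤ x * v + u * y
    cross = square-cancel-≤ (+-nonNegative (*-nonNegative 0≤p 0≤q) (*-nonNegative 0≤p 0≤q))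
                            (+-nonNegative (*-nonNegative 0≤x 0≤v) (*-nonNegative 0≤u 0≤y)) (begin
      (p * q + p * q) * (p * q + p * q)
        ≈⟨ solve 1 (λ r → (r :+ r) :* (r :+ r) := (r :* r :+ r :* r) :+ (r :* r :+ r :* r)) refl (p * q) ⟩
      (p * q * (p * q) + p * q * (p * q)) + (p * q * (p * q) + p * q * (p * q))
        ≈⟨ +-cong (+-cong pqpq≈ pqpq≈) (+-cong pqpq≈ pqpq≈) ⟩
      (x * v * (u * y) + x * v * (u * y)) + (x * v * (u * y) + x * v * (u * y))
        ≤⟨ 4xy≤[x+y]² (x * v) (u * y) ⟩
      (x * v + u * y) * (x * v + u * y)  ∎)

-- The weight of a job.

-- The fraction t of a machine that a job (μ, b) occupies, when the machine is
-- filled with scaled copies of the job, satisfies μ / t + √ (b / t) = 1, that is,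
-- (t - μ)² = b t; weight μ b is twice its larger root.
module Weight {c ℓ₁ ℓ₂} (ℝ : Reals c ℓ₁ ℓ₂) where

  open Order ℝ

  -- The discriminant (2μ + b)² - 4μ² of t² - (2μ + b) t + μ² in t, factored into two linear forms
  -- so that `√-superadditive` fits.
  discriminant : Carrier → Carrier → Carrier
  discriminant μ b = b * (b + ((μ + μ) + (μ + μ)))

  weight : Carrier → Carrier → Carrier
  weight μ b = (μ + μ + b) + √ discriminant μ b

  discriminant-nonNegative : ∀ {μ b} → 0# ≤ μ → 0# ≤ b → 0# ≤ discriminant μ b
  discriminant-nonNegative 0≤μ 0≤b =
    *-nonNegative 0≤b (+-nonNegative 0≤b (+-nonNegative 0≤2μ 0≤2μ))
    where 0≤2μ = +-nonNegative 0≤μ 0≤μ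

  weight-nonNegative : ∀ {μ b} → 0# ≤ μ → 0# ≤ b → 0# ≤ weight μ b
  weight-nonNegative 0≤μ 0≤b =
    +-nonNegative (+-nonNegative (+-nonNegative 0≤μ 0≤μ) 0≤b)
                  (√-nonNegative (discriminant-nonNegative 0≤μ 0≤b))

  weight-mono : ∀ {μ b μ′ b′} → 0# ≤ μ → 0# ≤ b → μ ≤ μ′ → b ≤ b′ → weight μ b ≤ weight μ′ b′
  weight-mono {μ} {b} {μ′} {b′} 0≤μ 0≤b μ≤μ′ b≤b′ =
    +-mono-≤ (+-mono-≤ 2μ≤2μ′ b≤b′)
      (√-mono (discriminant-nonNegative 0≤μ 0≤b)
        (*-mono-≤ 0≤b 0≤ b≤b′ (+-mono-≤ b≤b′ (+-mono-≤ 2μ≤2μ′ 2μ≤2μ′))))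
    where
    2μ≤2μ′ : μ + μ ≤ μ′ + μ′
    2μ≤2μ′ = +-mono-≤ μ≤μ′ μ≤μ′
    0≤2μ′ = +-nonNegative (≤-trans 0≤μ μ≤μ′) (≤-trans 0≤μ μ≤μ′)
    0≤ = +-nonNegative (≤-trans 0≤b b≤b′) (+-nonNegative 0≤2μ′ 0≤2μ′)

  -- The discriminant is a quadratic form, so scaling by k ≥ 0 multiplies its root by k.
  weight-scale : ∀ {k μ b} → 0# ≤ k → 0# ≤ μ → 0# ≤ b → weight (k * μ) (k * b) ≈ k * weight μ b
  weight-scale {k} {μ} {b} 0≤k 0≤μ 0≤b = begin-equality
    weight (k * μ) (k * b)
      ≈⟨ +-congˡ (√-unique (*-nonNegative 0≤k (√-nonNegative 0≤disc)) scaled) ⟩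
    (k * μ + k * μ + k * b) + k * r
      ≈⟨ solve 4 (λ k μ b r → (k :* μ :+ k :* μ :+ k :* b) :+ k :* r := k :* ((μ :+ μ :+ b) :+ r)) refl k μ b r ⟩
    k * weight μ b  ∎
    where
    0≤disc = discriminant-nonNegative 0≤μ 0≤b
    r = √ discriminant μ b
    scaled : (k * r) * (k * r) ≈ discriminant (k * μ) (k * b)
    scaled = begin-equality
      (k * r) * (k * r)           ≈⟨ solve 2 (λ k r → (k :* r) :* (k :* r) := k :* k :* (r :* r)) refl k r ⟩
      k * k * (r * r)             ≈⟨ *-congˡ (√-square 0≤disc) ⟩
      k * k * discriminant μ b
        ≈⟨ solve 3 (λ k μ b → k :* k :* (b :* (b :+ ((μ :+ μ) :+ (μ :+ μ))))
                     := (k :* b) :* (k :* b :+ ((k :* μ :+ k :* μ) :+ (k :* μ :+ k :* μ)))) refl k μ b ⟩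
      discriminant (k * μ) (k * b)  ∎

  -- The part 2μ + b is additive, and the discriminant is a product of two linear forms that are
  -- nonnegative on the quadrant, so `√-superadditive` handles its root.
  weight-superadditive : ∀ {μ b μ′ b′} → 0# ≤ μ → 0# ≤ b → 0# ≤ μ′ → 0# ≤ b′ →
                         weight μ b + weight μ′ b′ ≤ weight (μ + μ′) (b + b′)
  weight-superadditive {μ} {b} {μ′} {b′} 0≤μ 0≤b 0≤μ′ 0≤b′ = begin
    weight μ b + weight μ′ b′
      ≈⟨ solve 6 (λ μ b r μ′ b′ r′ → ((μ :+ μ :+ b) :+ r) :+ ((μ′ :+ μ′ :+ b′) :+ r′)
                   := ((μ :+ μ′) :+ (μ :+ μ′) :+ (b :+ b′)) :+ (r :+ r′)) refl
           μ b (√ discriminant μ b) μ′ b′ (√ discriminant μ′ b′) ⟩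
    ((μ + μ′) + (μ + μ′) + (b + b′)) + (√ discriminant μ b + √ discriminant μ′ b′)
      ≤⟨ +-monoʳ-≤ _ (≤-trans (√-superadditive 0≤b (0≤b+4μ 0≤μ 0≤b) 0≤b′ (0≤b+4μ 0≤μ′ 0≤b′))
           (√-mono (*-nonNegative (+-nonNegative 0≤b 0≤b′) (+-nonNegative (0≤b+4μ 0≤μ 0≤b) (0≤b+4μ 0≤μ′ 0≤b′)))
             (≤-reflexive (*-congˡ
               (solve 4 (λ μ b μ′ b′ → (b :+ ((μ :+ μ) :+ (μ :+ μ))) :+ (b′ :+ ((μ′ :+ μ′) :+ (μ′ :+ μ′)))
                 := (b :+ b′) :+ (((μ :+ μ′) :+ (μ :+ μ′)) :+ ((μ :+ μ′) :+ (μ :+ μ′)))) refl μ b μ′ b′))))) ⟩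
    weight (μ + μ′) (b + b′)  ∎
    where
    0≤b+4μ : ∀ {μ b} → 0# ≤ μ → 0# ≤ b → 0# ≤ b + ((μ + μ) + (μ + μ))
    0≤b+4μ 0≤μ 0≤b = +-nonNegative 0≤b (+-nonNegative (+-nonNegative 0≤μ 0≤μ) (+-nonNegative 0≤μ 0≤μ))

  -- The points (u (u + s), s²) with u + s = 1 parametrise the curve μ + √ b = 1;
  -- in this homogeneous form the discriminant is a perfect square.
  weight-curve : ∀ {u s} → 0# ≤ u → 0# ≤ s →
                 weight (u * (u + s)) (s * s) ≈ (u + s) * (u + s) + (u + s) * (u + s)
  weight-curve {u} {s} 0≤u 0≤s = begin-equality
    weight (u * (u + s)) (s * s)
      ≈⟨ +-congˡ (√-unique (*-nonNegative 0≤s (+-nonNegative 0≤s (+-nonNegative 0≤u 0≤u)))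
           (solve 2 (λ u s → (s :* (s :+ (u :+ u))) :* (s :* (s :+ (u :+ u)))
              := (s :* s) :* (s :* s :+ ((u :* (u :+ s) :+ u :* (u :+ s)) :+ (u :* (u :+ s) :+ u :* (u :+ s)))))
              refl u s)) ⟩
    (u * (u + s) + u * (u + s) + s * s) + s * (s + (u + u))
      ≈⟨ solve 2 (λ u s → (u :* (u :+ s) :+ u :* (u :+ s) :+ s :* s) :+ s :* (s :+ (u :+ u))
                   := (u :+ s) :* (u :+ s) :+ (u :+ s) :* (u :+ s)) refl u s ⟩
    (u + s) * (u + s) + (u + s) * (u + s)  ∎

  -- Keeping B and raising M to 1 - √B moves the point onto the curve μ + √b = 1, where the doubled
  -- weight is exactly 2; `weight` is monotone.
  weight-feasible : ∀ {M B} → 0# ≤ M → 0# ≤ B → M + √ B ≤ 1# → weight M B ≤ 1# + 1#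
  weight-feasible {M} {B} 0≤M 0≤B M+s≤1 = begin
    weight M B
      ≤⟨ weight-mono 0≤M 0≤B (≤-respʳ-≈ u≈ M≤u) (≤-reflexive (sym (√-square 0≤B))) ⟩
    weight (u * (u + s)) (s * s)
      ≈⟨ weight-curve (≤-trans 0≤M M≤u) (√-nonNegative 0≤B) ⟩
    (u + s) * (u + s) + (u + s) * (u + s)
      ≈⟨ +-cong u+s²≈1 u+s²≈1 ⟩
    1# + 1#  ∎
    where
    s = √ B
    u = 1# - s
    M≤u : M ≤ u
    M≤u = x+y≤z⇒x≤z-y M+s≤1
    u+s≈1 : u + s ≈ 1#
    u+s≈1 = trans (+-comm u s) (x+[y-x]≈y s 1#)
    u≈ : u ≈ u * (u + s)
    u≈ = sym (trans (*-congˡ u+s≈1) (*-identityʳ u))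
    u+s²≈1 : (u + s) * (u + s) ≈ 1#
    u+s²≈1 = trans (*-cong u+s≈1 u+s≈1) (*-identityˡ 1#)

  -- Below (M, B) lies a point of the form in `weight-curve` whose parameters add up to `a`. It is a
  -- point of the curve μ + √b = 1 shrunk by a²: the factor is squared because b scales linearly
  -- while the cost sees √b.
  weight-full : ∀ {M B a} → 0# ≤ M → 0# ≤ B → 0# ≤ a → a ≤ 1# → a ≤ M + √ B →
                a * a + a * a ≤ weight M B
  weight-full {M} {B} {a} 0≤M 0≤B 0≤a a≤1 a≤M+s with total a (√ B)
  -- Here `a` minus √B may be negative. Since √B alone reaches `a`, the parameters 0 and `a` serve.
  ... | inj₁ a≤s = begin
    a * a + a * a
      ≈⟨ +-cong (*-cong (+-identityˡ a) (+-identityˡ a)) (*-cong (+-identityˡ a) (+-identityˡ a)) ⟨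
    (0# + a) * (0# + a) + (0# + a) * (0# + a)
      ≈⟨ weight-curve ≤-refl 0≤a ⟨
    weight (0# * (0# + a)) (a * a)
      ≤⟨ weight-mono (≤-reflexive (sym (zeroˡ _))) (square-nonNegative a)
           (≤-respˡ-≈ (sym (zeroˡ _)) 0≤M)
           (≤-respʳ-≈ (√-square 0≤B) (*-mono-≤ 0≤a (√-nonNegative 0≤B) a≤s a≤s)) ⟩
    weight M B  ∎
  ... | inj₂ s≤a = begin
    a * a + a * a
      ≈⟨ +-cong (*-cong u+s≈a u+s≈a) (*-cong u+s≈a u+s≈a) ⟨
    (u + s) * (u + s) + (u + s) * (u + s)
      ≈⟨ weight-curve 0≤u (√-nonNegative 0≤B) ⟨
    weight (u * (u + s)) (s * s)
      ≤⟨ weight-mono (*-nonNegative 0≤u (≤-respʳ-≈ (sym u+s≈a) 0≤a)) (square-nonNegative s)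
           u[u+s]≤M (≤-reflexive (√-square 0≤B)) ⟩
    weight M B  ∎
    where
    s = √ B
    u = a - s
    0≤u : 0# ≤ u
    0≤u = y-x-nonNegative s≤a
    u+s≈a : u + s ≈ a
    u+s≈a = trans (+-comm u s) (x+[y-x]≈y s a)
    -- The factor u + s = a is at most 1, so the product is at most `u`, which `a≤M+s` bounds by M.
    u[u+s]≤M : u * (u + s) ≤ M
    u[u+s]≤M = begin
      u * (u + s)  ≤⟨ *-monoʳ-≤ 0≤u (≤-respˡ-≈ (sym u+s≈a) a≤1) ⟩
      u * 1#       ≈⟨ *-identityʳ u ⟩
      u            ≤⟨ x≤y+z⇒x-z≤y a≤M+s ⟩
      M            ∎

-- Finite sums over subsets and over machines.

module Sums {c ℓ₁ ℓ₂} (ℝ : Reals c ℓ₁ ℓ₂) where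

  open Order ℝ hiding (zero)
  open SubmodularBinPacking ℝ using (Σ[_]_)
  open SemiringSum semiring
    using (sum-cong-≋; sum-replicate-zero; ∑-comm; ∑-distrib-+; *-distribˡ-sum)

  sum-mono : ∀ {n} {f g : Fin n → Carrier} → (∀ i → f i ≤ g i) → sum f ≤ sum g
  sum-mono {zero}  f≤g = ≤-refl
  sum-mono {suc n} f≤g = +-mono-≤ (f≤g zero) (sum-mono λ i → f≤g (suc i))

  sum-nonNegative : ∀ {n} {f : Fin n → Carrier} → (∀ i → 0# ≤ f i) → 0# ≤ sum f
  sum-nonNegative {n} 0≤f = ≤-respˡ-≈ (sum-replicate-zero n) (sum-mono 0≤f)

  sum-const : ∀ n x → sum {n} (λ _ → x) ≈ fromℕ n * x
  sum-const zero    x = sym (zeroˡ x)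
  sum-const (suc n) x = begin-equality
    x + sum {n} (λ _ → x)      ≈⟨ +-cong (sym (*-identityˡ x)) (sum-const n x) ⟩
    1# * x + fromℕ n * x       ≈⟨ distribʳ x 1# (fromℕ n) ⟨
    (1# + fromℕ n) * x         ∎

  -- The summand inside `Σ[ S ] f`, named so that it can be passed explicitly to lemmas on `sum`.
  restrict : ∀ {n} → Subset n → (Fin n → Carrier) → Fin n → Carrier
  restrict S f j = if lookup S j then f j else 0#

  if-nonNegative : ∀ {x} s → 0# ≤ x → 0# ≤ (if s then x else 0#)
  if-nonNegative true  0≤x = 0≤x
  if-nonNegative false _   = ≤-refl

  Σ-nonNegative : ∀ {n} (S : Subset n) {f} → (∀ j → 0# ≤ f j) → 0# ≤ Σ[ S ] f
  Σ-nonNegative S 0≤f = sum-nonNegative λ j → if-nonNegative (lookup S j) (0≤f j)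

  Σ-mono : ∀ {n} (S : Subset n) {f g} → (∀ {j} → j ∈ S → f j ≤ g j) → Σ[ S ] f ≤ Σ[ S ] g
  Σ-mono S {f} {g} f≤g = sum-mono pointwise
    where
    pointwise : ∀ j → restrict S f j ≤ restrict S g j
    pointwise j with lookup S j in eq
    ... | true  = f≤g (lookup⇒[]= j S eq)
    ... | false = ≤-refl

  *-distribˡ-Σ : ∀ {n} x (S : Subset n) f → x * Σ[ S ] f ≈ Σ[ S ] (λ j → x * f j)
  *-distribˡ-Σ {n} x S f = trans (*-distribˡ-sum {n} x (restrict S f))
      (sum-cong-≋ {n} {λ j → x * restrict S f j} {restrict S λ j → x * f j} λ j → pointwise (lookup S j))
    where
    pointwise : ∀ s {y} → x * (if s then y else 0#) ≈ (if s then x * y else 0#)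
    pointwise true  = refl
    pointwise false = zeroʳ x

  Σ-distrib-+ : ∀ {n} (S : Subset n) f g → Σ[ S ] (λ j → f j + g j) ≈ Σ[ S ] f + Σ[ S ] g
  Σ-distrib-+ {n} S f g = trans
      (sum-cong-≋ {n} {restrict S λ j → f j + g j} {λ j → restrict S f j + restrict S g j}
        λ j → pointwise (lookup S j))
      (∑-distrib-+ {n} (restrict S f) (restrict S g))
    where
    pointwise : ∀ s {x y} → (if s then x + y else 0#) ≈ (if s then x else 0#) + (if s then y else 0#)
    pointwise true  = refl
    pointwise false = sym (+-identityˡ 0#)

  sum-indicator : ∀ {m} (k : Fin m) x → sum (λ i → if does (k Fin.≟ i) then x else 0#) ≈ x
  sum-indicator {suc m} zero    x = trans (+-congˡ (sum-replicate-zero m)) (+-identityʳ x)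
  sum-indicator {suc m} (suc k) x = trans (+-identityˡ _) (sum-indicator k x)

  -- Exchanging the sums leaves for each job a sum over machines with a single contribution, from
  -- the machine of that job.
  sum-jobs : ∀ {N m} (A : Assignment N m) f → sum (λ i → Σ[ jobs A i ] f) ≈ sum f
  sum-jobs {N} {m} A f = trans (∑-comm λ i → restrict (jobs A i) f)
    (sum-cong-≋ {N} {λ j → sum λ i → restrict (jobs A i) f j} {f} λ j →
      trans (sum-cong-≋ {m} {λ i → restrict (jobs A i) f j} λ i →
               reflexive (≡.cong (if_then f j else 0#) (lookup∘tabulate _ j)))
            (sum-indicator (Assignment.machine A j) (f j)))

-- Upper bound on the weights in a feasible set.

module Bounds {c ℓ₁ ℓ₂} (ℝ : Reals c ℓ₁ ℓ₂) {N} (μ b : Fin N → Reals.Carrier ℝ)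
              (inst : SubmodularBinPacking.IsInstance ℝ μ b) where

  open Order ℝ hiding (zero)
  open Weight ℝ
  open Sums ℝ
  open SubmodularBinPacking ℝ
  open IsInstance inst

  weights : Fin N → Carrier
  weights j = weight (μ j) (b j)

  -- Induction over all N jobs with `weight-superadditive`; jobs outside S take part as (0, 0).
  Σ-weights-≤ : ∀ S → Σ[ S ] weights ≤ weight (Σ[ S ] μ) (Σ[ S ] b)
  Σ-weights-≤ S = ≤-trans (sum-mono λ j → if-weight (lookup S j) j)
      (sum-weight (λ j → if-nonNegative (lookup S j) (μ-nonNegative j))
                  (λ j → if-nonNegative (lookup S j) (b-nonNegative j)))
    where
    if-weight : ∀ s j → (if s then weights j else 0#) ≤ weight (if s then μ j else 0#) (if s then b j else 0#)
    if-weight true  j = ≤-refl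
    if-weight false j = weight-nonNegative ≤-refl ≤-refl
    sum-weight : ∀ {n} {x y : Fin n → Carrier} → (∀ j → 0# ≤ x j) → (∀ j → 0# ≤ y j) →
                 sum (λ j → weight (x j) (y j)) ≤ weight (sum x) (sum y)
    sum-weight {zero}  0≤x 0≤y = weight-nonNegative ≤-refl ≤-refl
    sum-weight {suc n} {x} {y} 0≤x 0≤y = begin
      weight (x zero) (y zero) + sum (λ j → weight (x (suc j)) (y (suc j)))
        ≤⟨ +-monoʳ-≤ _ (sum-weight 0≤x⁺ 0≤y⁺) ⟩
      weight (x zero) (y zero) + weight (sum λ j → x (suc j)) (sum λ j → y (suc j))
        ≤⟨ weight-superadditive (0≤x zero) (0≤y zero) (sum-nonNegative 0≤x⁺) (sum-nonNegative 0≤y⁺) ⟩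
      weight (sum x) (sum y)  ∎
      where
      0≤x⁺ : ∀ j → 0# ≤ x (suc j)
      0≤x⁺ j = 0≤x (suc j)
      0≤y⁺ : ∀ j → 0# ≤ y (suc j)
      0≤y⁺ j = 0≤y (suc j)

  feasible⇒Σ-weights≤2 : ∀ S → Feasible μ b S → Σ[ S ] weights ≤ 1# + 1#
  feasible⇒Σ-weights≤2 S feasible = ≤-trans (Σ-weights-≤ S)
    (weight-feasible (Σ-nonNegative S μ-nonNegative) (Σ-nonNegative S b-nonNegative) feasible)

  -- Clearing denominators turns the extended ratios into one real inequality that also covers jobs
  -- with μ = 0.
  ratio-≤⇒*-≤ : ∀ {k j j′} → 0# ≤ k → ratio μ b j ≤⁺ scale μ b k (ratio μ b j′) →
                μ j′ * b j ≤ (k * b j′) * μ j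
  ratio-≤⇒*-≤ {k} {j} {j′} 0≤k ratio≤ with μ j ≟ 0# | μ j′ ≟ 0# | ratio≤
  -- When the right-hand ratio is infinite, the factor `μ j′` makes the left side 0.
  ... | _ | yes μj′≈0 | _ =
    ≤-respˡ-≈ (sym (trans (*-congʳ μj′≈0) (zeroˡ (b j))))
      (*-nonNegative (*-nonNegative 0≤k (b-nonNegative j′)) (μ-nonNegative j))
  -- An infinite ratio is never below a finite one, so this case is absurd.
  ... | yes _ | no _ | ()
  ... | no μj≉0 | no μj′≉0 | [ b/μ≤ ] = begin
    μ j′ * b j
      ≈⟨ *-congˡ (x*y/x≈y (b j) μj≉0) ⟨
    μ j′ * (μ j * b j * μ j ⁻¹)
      ≈⟨ solve 4 (λ x y z w → x :* (y :* z :* w) := (x :* y) :* (z :* w)) refl (μ j′) (μ j) (b j) (μ j ⁻¹) ⟩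
    (μ j′ * μ j) * (b j / μ j)
      ≤⟨ *-monoʳ-≤ (*-nonNegative (μ-nonNegative j′) (μ-nonNegative j)) b/μ≤ ⟩
    (μ j′ * μ j) * (k * (b j′ / μ j′))
      ≈⟨ solve 5 (λ x y k z w → (x :* y) :* (k :* (z :* w)) := (k :* (x :* z :* w)) :* y) refl
           (μ j′) (μ j) k (b j′) (μ j′ ⁻¹) ⟩
    (k * (μ j′ * b j′ / μ j′)) * μ j
      ≈⟨ *-congʳ (*-congˡ (x*y/x≈y (b j′) μj′≉0)) ⟩
    (k * b j′) * μ j  ∎

  -- Lower bound on the weights in a full homogeneous machine.

  module _ {δ} (0≤δ : 0# ≤ δ) (S : Subset N) (homogeneous : Homogeneous μ b δ S) where

    private
      k = 1# + δ
      M = Σ[ S ] μ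
      B = Σ[ S ] b
      W = Σ[ S ] weights

    1≤k : 1# ≤ k
    1≤k = x≤x+y 1# 0≤δ

    0≤k : 0# ≤ k
    0≤k = ≤-trans 0≤1 1≤k

    0≤M : 0# ≤ M
    0≤M = Σ-nonNegative S μ-nonNegative

    0≤B : 0# ≤ B
    0≤B = Σ-nonNegative S b-nonNegative

    x≤kx : ∀ {x} → 0# ≤ x → x ≤ k * x
    x≤kx 0≤x = ≤-respˡ-≈ (*-identityˡ _) (*-monoˡ-≤ 0≤x 1≤k)

    cross : ∀ {j j′} → j ∈ S → j′ ∈ S → μ j′ * b j ≤ (k * b j′) * μ j
    cross j∈S j′∈S = ratio-≤⇒*-≤ 0≤k (homogeneous j∈S j′∈S)

    -- Summing `cross` over j′ replaces the other job by the total (M, B). This compares B / M with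
    -- b j / μ j without dividing; `b*M≤` is the opposite comparison.
    μ*B≤ : ∀ {j} → j ∈ S → μ j * B ≤ (k * b j) * M
    μ*B≤ {j} j∈S = begin
      μ j * B                            ≈⟨ *-distribˡ-Σ (μ j) S b ⟩
      Σ[ S ] (λ j′ → μ j * b j′)         ≤⟨ Σ-mono S (λ j′∈S → cross j′∈S j∈S) ⟩
      Σ[ S ] (λ j′ → (k * b j) * μ j′)   ≈⟨ *-distribˡ-Σ (k * b j) S μ ⟨
      (k * b j) * M                      ∎

    b*M≤ : ∀ {j} → j ∈ S → b j * M ≤ (k * μ j) * B
    b*M≤ {j} j∈S = begin
      b j * M                            ≈⟨ *-distribˡ-Σ (b j) S μ ⟩
      Σ[ S ] (λ j′ → b j * μ j′)         ≤⟨ Σ-mono S (λ {j′} j′∈S → swapped j′ (cross j∈S j′∈S)) ⟩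
      Σ[ S ] (λ j′ → (k * μ j) * b j′)   ≈⟨ *-distribˡ-Σ (k * μ j) S b ⟨
      (k * μ j) * B                      ∎
      where
      swapped : ∀ j′ → μ j′ * b j ≤ (k * b j′) * μ j → b j * μ j′ ≤ (k * μ j) * b j′
      swapped j′ h = ≤-respˡ-≈ (*-comm (μ j′) (b j))
        (≤-respʳ-≈ (solve 3 (λ k x y → (k :* x) :* y := (k :* y) :* x) refl k (b j′) (μ j)) h)

    -- Up to the factor k, every job of S is the share (μ + b) / (M + B) of the
    -- total (M, B); sharing by μ + b avoids treating M = 0 separately.
    weight-share : ∀ {j} → j ∈ S → weight M B * (μ j + b j) ≤ (k * (M + B)) * weights j
    weight-share {j} j∈S = begin
      weight M B * d              ≈⟨ *-comm (weight M B) d ⟩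
      d * weight M B              ≈⟨ weight-scale 0≤d 0≤M 0≤B ⟨
      weight (d * M) (d * B)      ≤⟨ weight-mono (*-nonNegative 0≤d 0≤M) (*-nonNegative 0≤d 0≤B) dM≤ dB≤ ⟩
      weight (kD * μ j) (kD * b j)
        ≈⟨ weight-scale (*-nonNegative 0≤k (+-nonNegative 0≤M 0≤B)) (μ-nonNegative j) (b-nonNegative j) ⟩
      kD * weights j              ∎
      where
      d = μ j + b j
      kD = k * (M + B)
      0≤d : 0# ≤ d
      0≤d = +-nonNegative (μ-nonNegative j) (b-nonNegative j)
      dM≤ : d * M ≤ kD * μ j
      dM≤ = begin
        d * M                          ≈⟨ distribʳ M (μ j) (b j) ⟩
        μ j * M + b j * M
          ≤⟨ +-mono-≤ (x≤kx (*-nonNegative (μ-nonNegative j) 0≤M)) (b*M≤ j∈S) ⟩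
        k * (μ j * M) + (k * μ j) * B
          ≈⟨ solve 4 (λ k x M B → k :* (x :* M) :+ (k :* x) :* B := (k :* (M :+ B)) :* x) refl k (μ j) M B ⟩
        kD * μ j                       ∎
      dB≤ : d * B ≤ kD * b j
      dB≤ = begin
        d * B                          ≈⟨ distribʳ B (μ j) (b j) ⟩
        μ j * B + b j * B
          ≤⟨ +-mono-≤ (μ*B≤ j∈S) (x≤kx (*-nonNegative (b-nonNegative j) 0≤B)) ⟩
        (k * b j) * M + k * (b j * B)
          ≈⟨ solve 4 (λ k x M B → (k :* x) :* M :+ k :* (x :* B) := (k :* (M :+ B)) :* x) refl k (b j) M B ⟩
        kD * b j                       ∎

    -- Summed over S, the factors `μ j + b j` of `weight-share` add up to M + B, which then cancels.
    weight-≤-kW : 0# < M + B → weight M B ≤ k * W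
    weight-≤-kW 0<M+B = *-cancelˡ-≤ 0<M+B (begin
      (M + B) * weight M B
        ≈⟨ *-comm (M + B) (weight M B) ⟩
      weight M B * (M + B)
        ≈⟨ *-congˡ (Σ-distrib-+ S μ b) ⟨
      weight M B * Σ[ S ] (λ j → μ j + b j)
        ≈⟨ *-distribˡ-Σ (weight M B) S (λ j → μ j + b j) ⟩
      Σ[ S ] (λ j → weight M B * (μ j + b j))
        ≤⟨ Σ-mono S weight-share ⟩
      Σ[ S ] (λ j → (k * (M + B)) * weights j)
        ≈⟨ *-distribˡ-Σ (k * (M + B)) S weights ⟨
      (k * (M + B)) * W
        ≈⟨ solve 3 (λ k D W → (k :* D) :* W := D :* (k :* W)) refl k (M + B) W ⟩
      (M + B) * (k * W)  ∎)

    -- The product is 1 - δ², so multiplying by 1 - δ can stand in for dividing by 1 + δ. Writing 1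
    -- as `δ + e` avoids subtraction.
    [1-δ]k≤1 : (1# - δ) * k ≤ 1#
    [1-δ]k≤1 = begin
      e * (1# + δ)           ≈⟨ *-congˡ (+-congʳ δ+e≈1) ⟨
      e * ((δ + e) + δ)      ≤⟨ x≤x+y _ (square-nonNegative δ) ⟩
      e * ((δ + e) + δ) + δ * δ
        ≈⟨ solve 2 (λ e δ → e :* ((δ :+ e) :+ δ) :+ δ :* δ := (δ :+ e) :* (δ :+ e)) refl e δ ⟩
      (δ + e) * (δ + e)      ≈⟨ *-cong δ+e≈1 δ+e≈1 ⟩
      1# * 1#                ≈⟨ *-identityˡ 1# ⟩
      1#                     ∎
      where
      e = 1# - δ
      δ+e≈1 : δ + e ≈ 1#
      δ+e≈1 = x+[y-x]≈y δ 1#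

    -- Provides the divisor for `weight-≤-kW`: if M + B were 0, both M and √B would be at most 0,
    -- and so would `a`.
    full⇒M+B-positive : ∀ {a} → 0# < a → a ≤ M + √ B → 0# < M + B
    full⇒M+B-positive {a} (0≤a , 0≉a) a≤M+s = +-nonNegative 0≤M 0≤B , λ 0≈M+B → 0≉a (antisym 0≤a (begin
      a         ≤⟨ a≤M+s ⟩
      M + √ B   ≤⟨ +-mono-≤ (≤-trans (x≤x+y M 0≤B) (≤-reflexive (sym 0≈M+B)))
                     (√-upper 0≤B ≤-refl (≤-trans (x≤y+x B 0≤M)
                       (≤-reflexive (trans (sym 0≈M+B) (sym (zeroˡ 0#)))))) ⟩
      0# + 0#   ≈⟨ +-identityˡ 0# ⟩
      0#        ∎))

    -- Fullness bounds the weight of the total, `weight-≤-kW` passes to W at the cost of k, and the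
    -- factor 1 - δ absorbs k. The bound is d + d because `weight` is twice the occupied fraction.
    full⇒Σ-weights≥ : ∀ {ε} → 0# ≤ ε → ε < 1# → δ < 1# → Full μ b ε S →
                      let d = (1# - ε) * (1# - ε) * (1# - δ) in d + d ≤ W
    full⇒Σ-weights≥ {ε} 0≤ε ε<1 (δ≤1 , _) full = begin
      a * a * e + a * a * e  ≈⟨ solve 2 (λ x e → x :* e :+ x :* e := e :* (x :+ x)) refl (a * a) e ⟩
      e * (a * a + a * a)    ≤⟨ *-monoʳ-≤ 0≤e (weight-full 0≤M 0≤B (proj₁ 0<a) a≤1 full) ⟩
      e * weight M B         ≤⟨ *-monoʳ-≤ 0≤e (weight-≤-kW (full⇒M+B-positive 0<a full)) ⟩
      e * (k * W)            ≈⟨ *-assoc e k W ⟨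
      (e * k) * W            ≤⟨ *-monoˡ-≤ 0≤W [1-δ]k≤1 ⟩
      1# * W                 ≈⟨ *-identityˡ W ⟩
      W                      ∎
      where
      a = 1# - ε
      e = 1# - δ
      0<a : 0# < a
      0<a = y-x-positive ε<1
      a≤1 : a ≤ 1#
      a≤1 = x≤y+z⇒x-z≤y (x≤x+y 1# 0≤ε)
      0≤e : 0# ≤ e
      0≤e = y-x-nonNegative δ≤1
      0≤W : 0# ≤ W
      0≤W = Σ-nonNegative S λ j → weight-nonNegative (μ-nonNegative j) (b-nonNegative j)

-- Comparison of the two assignments.

theorem5 : ∀ {c ℓ₁ ℓ₂} (ℝ : Reals c ℓ₁ ℓ₂) →
    let open Reals ℝ
        open SubmodularBinPacking ℝ
    in
    ∀ (N : ℕ) (μ b : Fin N → Carrier) → IsInstance μ b →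
    ∀ (ε δ : Carrier) → 0# ≤ ε → ε < 1# → 0# ≤ δ → δ < 1# →
    ∀ (m : ℕ) (A : Assignment N m) →
    (∀ i → Full μ b ε (jobs A i)) →
    (∀ i → Homogeneous μ b δ (jobs A i)) →
    ∀ (OPT : ℕ) → IsOPT μ b OPT →
    fromℕ m ≤ fromℕ OPT / ((1# - ε) * (1# - ε) * (1# - δ))
theorem5 ℝ N μ b inst ε δ 0≤ε ε<1 0≤δ δ<1 m A full homogeneous OPT ((T , feasible) , _) =
  -- The doubling of the weights makes both sides appear twice; it is removed first, and then the
  -- positive `d` is divided out.
  x*z≤y⇒x≤y/z 0<d (x+x≤y+y⇒x≤y (begin
    fromℕ m * d + fromℕ m * d                      ≈⟨ distribˡ (fromℕ m) d d ⟨
    fromℕ m * (d + d)                              ≈⟨ sum-const m (d + d) ⟨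
    sum {m} (λ _ → d + d)
      ≤⟨ sum-mono (λ i → full⇒Σ-weights≥ 0≤δ (jobs A i) (homogeneous i) 0≤ε ε<1 δ<1 (full i)) ⟩
    sum (λ i → Σ[ jobs A i ] weights)              ≈⟨ sum-jobs A weights ⟩
    sum weights                                    ≈⟨ sum-jobs T weights ⟨
    sum (λ i → Σ[ jobs T i ] weights)
      ≤⟨ sum-mono (λ i → feasible⇒Σ-weights≤2 (jobs T i) (feasible i)) ⟩
    sum {OPT} (λ _ → 1# + 1#)                      ≈⟨ sum-const OPT (1# + 1#) ⟩
    fromℕ OPT * (1# + 1#)                          ≈⟨ distribˡ (fromℕ OPT) 1# 1# ⟩
    fromℕ OPT * 1# + fromℕ OPT * 1#                ≈⟨ +-cong (*-identityʳ _) (*-identityʳ _) ⟩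
    fromℕ OPT + fromℕ OPT                          ∎))
  where
  open Order ℝ hiding (zero)
  open Sums ℝ
  open Bounds ℝ μ b inst
  open SubmodularBinPacking ℝ using (Σ[_]_)
  d = (1# - ε) * (1# - ε) * (1# - δ)
  0<d : 0# < d
  0<d = *-positive (*-positive (y-x-positive ε<1) (y-x-positive ε<1)) (y-x-positive δ<1)
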